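{- The following rules are validated (types interpreted in the category model, displayed types in the displayed category model): (Twist) if $\Gamma.b:B^{\mathrm{op}}\vdash C\,\mathsf{Ty}$ then $\Gamma.b:B\vdash\mathsf{Tw}_b(C)\,\mathsf{Ty}_d$; (Twist-Weak) if $\Gamma\vdash B\,\mathsf{Ty}$ and $\Gamma\vdash C\,\mathsf{Ty}$, then $\Gamma.b:B\vdash\mathsf{Tw}_b(C)\equiv C\,\mathsf{Ty}_d$, i.e. the twist of a type $C$ not depending on $b$ equals the weakening of $C$ to $\Gamma.b:B$, regarded as a displayed type. Here $\mathsf{Tw}_b(C)$ is interpreted as the displayed category corresponding to the projection $\pi_2:\Gamma\diamond(B\ltimes C)\to\Gamma\diamond B$.
   Context: For a strict functor $F:\Gamma\to\mathbf{Cat}$, $\Gamma\diamond F$ is the covariant Grothendieck construction: objects $(\gamma,x)$ with $x\in F(\gamma)$, morphisms $(g:\gamma\to\gamma',\ \xi:F(g)x\to x')$. $F^{\mathrm{op}}:=\mathrm{op}\circ F$. Category model: a context is a category $\Gamma$, a type $\Gamma\vdash A\,\mathsf{Ty}$ is a strict functor $A:\Gamma\to\mathbf{Cat}$, $\Gamma.a:A$ is $\Gamma\diamond A$, substitution is precomposition, and $A^{\mathrm{op}}$ is $\mathrm{op}\circ A$. Displayed category model: a displayed type $\Gamma\vdash D\,\mathsf{Ty}_d$ is a normal lax functor $D:\Gamma\to\mathbf{Cat}_{\mathsf{Prof}}$ (the bicategory of categories and profunctors): categories $D(\gamma)$, profunctors $D(g):D(\gamma)^{\mathrm{op}}\times D(\gamma')\to\mathbf{Set}$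 for $g:\gamma\to\gamma'$, with $D(\mathrm{id})=\hom$ and unital associative composition maps. Its total category has objects $(\gamma,x)$, $x\in D(\gamma)$, and morphisms $(g,u)$ with $u\in D(g)(x,x')$; this gives an equivalence between displayed categories over $\Gamma$ and functors into $\Gamma$. A type $A:\Gamma\to\mathbf{Cat}$ is regarded as the displayed type $\gamma\mapsto A(\gamma)$, $g\mapsto\hom_{A(\gamma')}(A(g)-,-)$. For $C:\Gamma\diamond B^{\mathrm{op}}\to\mathbf{Cat}$, $\Gamma\diamond(B\ltimes C)$ is the category with objects $(\gamma,b,c)$, $b\in B(\gamma)$, $c\in C(\gamma,b)$, and morphisms $(\gamma,b,c)\to(\gamma',b',c')$ triples $(g,\beta,\theta)$ with $g:\gamma\to\gamma'$, $\beta:B(g)b\to b'$, $\theta:C(g,\mathrm{id}_{B(g)b})c\to C(\mathrm{id}_{\gamma'},\beta)c'$; $\pi_2$ forgets $c$ and $\theta$. The corresponding displayed category over $\Gamma\diamond B$ is $(\gamma,b)\mapsto C(\gamma,b)$, $(g,\beta)\mapsto\big((c,c')\mapsto\hom(C(g,\mathrm{id})c,C(\mathrm{id},\beta)c')\big)$. -}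

module Defs where

open import Level using (Level; _⊔_; suc)
open import Data.Product using (Σ; Σ-syntax; _,_; proj₁; proj₂)
open import Relation.Binary.PropositionalEquality
  using (_≡_; refl; sym; trans; cong; cong₂; subst; subst₂; module ≡-Reasoning)
open import Relation.Binary.HeterogeneousEquality using (_≅_; refl; ≡-to-≅; ≡-subst-removable)
  renaming (trans to ≅-trans)

private
  variable
    o h o₁ h₁ o₂ h₂ o₃ h₃ ℓ : Level

-- Hom-sets are types compared with _≡_, which axiom K makes sets.  Equations
-- between morphisms whose endpoints agree only propositionally are stated
-- with _≅_, always next to the equations between the endpoints.

record Category (o h : Level) : Set (suc (o ⊔ h)) where
  infixr 9 _∘_
  field
    Ob    : Set o
    Hom   : Ob → Ob → Set h
    id    : ∀ {x} → Hom x x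
    _∘_   : ∀ {x y z} → Hom y z → Hom x y → Hom x z
    idˡ   : ∀ {x y} (f : Hom x y) → id ∘ f ≡ f
    idʳ   : ∀ {x y} (f : Hom x y) → f ∘ id ≡ f
    assoc : ∀ {w x y z} (f : Hom y z) (g : Hom x y) (k : Hom w x) →
            (f ∘ g) ∘ k ≡ f ∘ (g ∘ k)

  ≡⇒Hom : ∀ {x y} → x ≡ y → Hom x y
  ≡⇒Hom refl = id

op : Category o h → Category o h
op 𝒞 = record
  { Ob    = Ob
  ; Hom   = λ x y → Hom y x
  ; id    = id
  ; _∘_   = λ f g → g ∘ f
  ; idˡ   = idʳ
  ; idʳ   = idˡ
  ; assoc = λ f g k → sym (assoc k g f)
  }
  where open Category 𝒞

record Functor (𝒞 : Category o₁ h₁) (𝒟 : Category o₂ h₂) :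
               Set (o₁ ⊔ h₁ ⊔ o₂ ⊔ h₂) where
  private
    module 𝒞 = Category 𝒞
    module 𝒟 = Category 𝒟
  field
    F₀   : 𝒞.Ob → 𝒟.Ob
    F₁   : ∀ {x y} → 𝒞.Hom x y → 𝒟.Hom (F₀ x) (F₀ y)
    F-id : ∀ {x} → F₁ (𝒞.id {x}) ≡ 𝒟.id
    F-∘  : ∀ {x y z} (f : 𝒞.Hom y z) (g : 𝒞.Hom x y) →
           F₁ (f 𝒞.∘ g) ≡ F₁ f 𝒟.∘ F₁ g

open Functor

idF : {𝒞 : Category o h} → Functor 𝒞 𝒞
idF = record { F₀ = λ x → x ; F₁ = λ f → f ; F-id = refl ; F-∘ = λ _ _ → refl }

infixr 9 _∘F_
_∘F_ : {𝒞 : Category o₁ h₁} {𝒟 : Category o₂ h₂} {ℰ : Category o₃ h₃} →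
       Functor 𝒟 ℰ → Functor 𝒞 𝒟 → Functor 𝒞 ℰ
G ∘F F = record
  { F₀   = λ x → F₀ G (F₀ F x)
  ; F₁   = λ f → F₁ G (F₁ F f)
  ; F-id = trans (cong (F₁ G) (F-id F)) (F-id G)
  ; F-∘  = λ f g → trans (cong (F₁ G) (F-∘ F f g)) (F-∘ G (F₁ F f) (F₁ F g))
  }

opF : {𝒞 : Category o₁ h₁} {𝒟 : Category o₂ h₂} → Functor 𝒞 𝒟 → Functor (op 𝒞) (op 𝒟)
opF F = record
  { F₀ = F₀ F ; F₁ = F₁ F ; F-id = F-id F ; F-∘ = λ f g → F-∘ F g f }

-- Equality of functors, unfolded pointwise because function extensionality is
-- not available.

infix 4 _≗F_
record _≗F_ {𝒞 : Category o₁ h₁} {𝒟 : Category o₂ h₂} (F G : Functor 𝒞 𝒟) :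
            Set (o₁ ⊔ h₁ ⊔ o₂ ⊔ h₂) where
  field
    eq₀ : ∀ x → F₀ F x ≡ F₀ G x
    eq₁ : ∀ {x y} (f : Category.Hom 𝒞 x y) → F₁ F f ≅ F₁ G f

open _≗F_

-- p and q are isomorphic as objects of the slice over Γ; the condition on
-- from follows from over and to∘from.

record IsoOver {Γ : Category o h} {𝒞 : Category o₁ h₁} {𝒟 : Category o₂ h₂}
               (p : Functor 𝒞 Γ) (q : Functor 𝒟 Γ) :
               Set (o ⊔ h ⊔ o₁ ⊔ h₁ ⊔ o₂ ⊔ h₂) where
  field
    to      : Functor 𝒞 𝒟
    from    : Functor 𝒟 𝒞
    from∘to : from ∘F to ≗F idF
    to∘from : to ∘F from ≗F idF
    over    : q ∘F to ≗F p

record Ty (Γ : Category o h) (o₁ h₁ : Level) : Set (o ⊔ h ⊔ suc (o₁ ⊔ h₁)) where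
  open Category Γ
  field
    Fib   : Ob → Category o₁ h₁
    Re    : ∀ {γ γ'} → Hom γ γ' → Functor (Fib γ) (Fib γ')
    Re-id : ∀ {γ} → Re (id {γ}) ≗F idF
    Re-∘  : ∀ {γ γ' γ''} (g' : Hom γ' γ'') (g : Hom γ γ') → Re (g' ∘ g) ≗F Re g' ∘F Re g

  module Fib {γ : Ob} = Category (Fib γ)

  re₀ : ∀ {γ γ'} → Hom γ γ' → Fib.Ob {γ} → Fib.Ob {γ'}
  re₀ g = F₀ (Re g)

  re₁ : ∀ {γ γ'} (g : Hom γ γ') {x y : Fib.Ob} → Fib.Hom x y → Fib.Hom (re₀ g x) (re₀ g y)
  re₁ g = F₁ (Re g)

  re₀-id : ∀ {γ} (x : Fib.Ob {γ}) → re₀ id x ≡ x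
  re₀-id = eq₀ Re-id

  re₀-∘ : ∀ {γ γ' γ''} (g' : Hom γ' γ'') (g : Hom γ γ') (x : Fib.Ob) →
          re₀ (g' ∘ g) x ≡ re₀ g' (re₀ g x)
  re₀-∘ g' g = eq₀ (Re-∘ g' g)

  re₁⁺ : ∀ {γ γ' γ''} (g' : Hom γ' γ'') (g : Hom γ γ') {x : Fib.Ob} {y : Fib.Ob} →
         Fib.Hom (re₀ g x) y → Fib.Hom (re₀ (g' ∘ g) x) (re₀ g' y)
  re₁⁺ g' g ξ = re₁ g' ξ Fib.∘ Fib.≡⇒Hom (re₀-∘ g' g _)

infix 20 _ᵒᵖ
_ᵒᵖ : {Γ : Category o h} → Ty Γ o₁ h₁ → Ty Γ o₁ h₁
A ᵒᵖ = record
  { Fib   = λ γ → op (Fib γ)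
  ; Re    = λ g → opF (Re g)
  ; Re-id = record { eq₀ = eq₀ Re-id ; eq₁ = eq₁ Re-id }
  ; Re-∘  = λ g' g → record { eq₀ = eq₀ (Re-∘ g' g) ; eq₁ = eq₁ (Re-∘ g' g) }
  }
  where open Ty A

infixl 15 _[_]
_[_] : {Δ : Category o h} {Γ : Category o₂ h₂} → Ty Γ o₁ h₁ → Functor Δ Γ → Ty Δ o₁ h₁
A [ σ ] = record
  { Fib   = λ δ → Fib (F₀ σ δ)
  ; Re    = λ g → Re (F₁ σ g)
  ; Re-id = subst (λ k → Re k ≗F idF) (sym (F-id σ)) Re-id
  ; Re-∘  = λ g' g → subst (λ k → Re k ≗F Re (F₁ σ g') ∘F Re (F₁ σ g))
                           (sym (F-∘ σ g' g)) (Re-∘ (F₁ σ g') (F₁ σ g))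
  }
  where open Ty A

-- Arrows with unspecified endpoints, used to reason about equations between
-- morphisms whose endpoints agree only propositionally.

module Arrows (𝒞 : Category o h) where
  open Category 𝒞

  record Arr : Set (o ⊔ h) where
    constructor arr
    field
      {dom cod} : Ob
      mor       : Hom dom cod

  arr⁻¹ : ∀ {x y} {f g : Hom x y} → arr f ≡ arr g → f ≡ g
  arr⁻¹ refl = refl

  ≡⇒Hom-∘ : ∀ {x y z} (p : y ≡ z) (f : Hom x y) → arr (≡⇒Hom p ∘ f) ≡ arr f
  ≡⇒Hom-∘ refl f = cong arr (idˡ f)

  ∘-≡⇒Hom : ∀ {x y z} (f : Hom y z) (p : x ≡ y) → arr (f ∘ ≡⇒Hom p) ≡ arr f
  ∘-≡⇒Hom f refl = cong arr (idʳ f)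

module FibreArrows {Γ : Category o h} (A : Ty Γ o₁ h₁) where
  open Category Γ using (Ob; Hom; id; _∘_)
  open Ty A
  private module Γ = Arrows Γ

  record Arr : Set (o ⊔ o₁ ⊔ h₁) where
    constructor arr
    field
      {base}    : Ob
      {dom cod} : Fib.Ob {base}
      mor       : Fib.Hom dom cod

  arr⁻¹ : ∀ {γ} {x y : Fib.Ob {γ}} {f g : Fib.Hom x y} → arr f ≡ arr g → f ≡ g
  arr⁻¹ refl = refl

  arr⇒≅ : ∀ {γ γ'} {x y : Fib.Ob {γ}} {x' y' : Fib.Ob {γ'}}
            {f : Fib.Hom x y} {f' : Fib.Hom x' y'} → arr f ≡ arr f' → f ≅ f'
  arr⇒≅ refl = refl

  ≅⇒arr : ∀ {γ} {x y x' y' : Fib.Ob {γ}} {f : Fib.Hom x y} {f' : Fib.Hom x' y'} →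
          x ≡ x' → y ≡ y' → f ≅ f' → arr f ≡ arr f'
  ≅⇒arr refl refl refl = refl

  inFibre : ∀ {γ} {x y x' y' : Fib.Ob {γ}} {f : Fib.Hom x y} {f' : Fib.Hom x' y'} →
            Arrows.arr {𝒞 = Fib γ} f ≡ Arrows.arr f' → arr f ≡ arr f'
  inFibre refl = refl

  ∘-cong : ∀ {γ γ'} {x y z : Fib.Ob {γ}} {x' y' z' : Fib.Ob {γ'}}
             {f : Fib.Hom y z} {g : Fib.Hom x y} {f' : Fib.Hom y' z'} {g' : Fib.Hom x' y'} →
           arr f ≡ arr f' → arr g ≡ arr g' → arr (f Fib.∘ g) ≡ arr (f' Fib.∘ g')
  ∘-cong refl refl = refl

  ≡⇒Hom-∘ : ∀ {γ} {x y z : Fib.Ob {γ}} (p : y ≡ z) (f : Fib.Hom x y) →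
            arr (Fib.≡⇒Hom p Fib.∘ f) ≡ arr f
  ≡⇒Hom-∘ p f = inFibre (Arrows.≡⇒Hom-∘ (Fib _) p f)

  ∘-≡⇒Hom : ∀ {γ} {x y z : Fib.Ob {γ}} (f : Fib.Hom y z) (p : x ≡ y) →
            arr (f Fib.∘ Fib.≡⇒Hom p) ≡ arr f
  ∘-≡⇒Hom f p = inFibre (Arrows.∘-≡⇒Hom (Fib _) f p)

  ≡⇒Hom-arr : ∀ {γ} {x y : Fib.Ob {γ}} (p : x ≡ y) → arr (Fib.≡⇒Hom p) ≡ arr (Fib.id {γ} {y})
  ≡⇒Hom-arr refl = refl

  id-arr : ∀ {γ γ'} {x : Fib.Ob {γ}} {x' : Fib.Ob {γ'}} →
           _≡_ {A = Σ Ob λ γ → Fib.Ob {γ}} (γ , x) (γ' , x') →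
           arr (Fib.id {γ} {x}) ≡ arr (Fib.id {γ'} {x'})
  id-arr refl = refl

  re-cong : ∀ {γ δ γ' δ'} {k : Hom γ δ} {k' : Hom γ' δ'}
              {x y : Fib.Ob} {x' y' : Fib.Ob} {f : Fib.Hom x y} {f' : Fib.Hom x' y'} →
            Γ.arr k ≡ Γ.arr k' → arr f ≡ arr f' → arr (re₁ k f) ≡ arr (re₁ k' f')
  re-cong refl refl = refl

  re-pres-id : ∀ {γ γ'} (g : Hom γ γ') {x : Fib.Ob} →
               arr (re₁ g (Fib.id {x = x})) ≡ arr (Fib.id {x = re₀ g x})
  re-pres-id g = cong arr (F-id (Re g))

  absorbˡ : ∀ {γ δ} {x y z : Fib.Ob {γ}} {w : Fib.Ob {δ}} {u : Fib.Hom y z} {f : Fib.Hom x y} →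
            arr u ≡ arr (Fib.id {x = w}) → arr (u Fib.∘ f) ≡ arr f
  absorbˡ refl = cong arr (Fib.idˡ _)

  absorbʳ : ∀ {γ δ} {x y z : Fib.Ob {γ}} {w : Fib.Ob {δ}} {u : Fib.Hom x y} {f : Fib.Hom y z} →
            arr u ≡ arr (Fib.id {x = w}) → arr (f Fib.∘ u) ≡ arr f
  absorbʳ refl = cong arr (Fib.idʳ _)

  re-id : ∀ {γ} {x y : Fib.Ob {γ}} (f : Fib.Hom x y) → arr (re₁ id f) ≡ arr f
  re-id f = ≅⇒arr (re₀-id _) (re₀-id _) (eq₁ Re-id f)

  re-≡id : ∀ {γ γ' δ} {k : Hom γ γ'} {x y : Fib.Ob} (f : Fib.Hom x y) →
           Γ.arr k ≡ Γ.arr (id {δ}) → arr (re₁ k f) ≡ arr f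
  re-≡id f refl = re-id f

  re-∘ : ∀ {γ γ' γ''} (g' : Hom γ' γ'') (g : Hom γ γ') {x y : Fib.Ob} (f : Fib.Hom x y) →
         arr (re₁ (g' ∘ g) f) ≡ arr (re₁ g' (re₁ g f))
  re-∘ g' g f = ≅⇒arr (re₀-∘ g' g _) (re₀-∘ g' g _) (eq₁ (Re-∘ g' g) f)

  re⁺ : ∀ {γ γ' γ''} (g' : Hom γ' γ'') (g : Hom γ γ') {x : Fib.Ob} {y : Fib.Ob}
          (ξ : Fib.Hom (re₀ g x) y) →
        arr (re₁⁺ g' g ξ) ≡ arr (re₁ g' ξ)
  re⁺ g' g ξ = ∘-≡⇒Hom (re₁ g' ξ) (re₀-∘ g' g _)

  ⊙-assoc : ∀ {γ γ' γ'' γ'''} (g'' : Hom γ'' γ''') (g' : Hom γ' γ'') (g : Hom γ γ')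
              {w : Fib.Ob} {x : Fib.Ob} {y : Fib.Ob} {z : Fib.Ob}
              (ξ'' : Fib.Hom (re₀ g'' y) z) (ξ' : Fib.Hom (re₀ g' x) y) (ξ : Fib.Hom (re₀ g w) x) →
            arr ((ξ'' Fib.∘ re₁⁺ g'' g' ξ') Fib.∘ re₁⁺ (g'' ∘ g') g ξ) ≡
            arr (ξ'' Fib.∘ re₁⁺ g'' (g' ∘ g) (ξ' Fib.∘ re₁⁺ g' g ξ))
  ⊙-assoc g'' g' g ξ'' ξ' ξ = begin
    arr ((ξ'' Fib.∘ re₁⁺ g'' g' ξ') Fib.∘ re₁⁺ (g'' ∘ g') g ξ)
      ≡⟨ ∘-cong (∘-cong refl (re⁺ g'' g' ξ')) (trans (re⁺ (g'' ∘ g') g ξ) (re-∘ g'' g' ξ)) ⟩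
    arr ((ξ'' Fib.∘ re₁ g'' ξ') Fib.∘ re₁ g'' (re₁ g' ξ))
      ≡⟨ cong arr (Fib.assoc _ _ _) ⟩
    arr (ξ'' Fib.∘ (re₁ g'' ξ' Fib.∘ re₁ g'' (re₁ g' ξ)))
      ≡⟨ ∘-cong refl (cong arr (F-∘ (Re g'') _ _)) ⟨
    arr (ξ'' Fib.∘ re₁ g'' (ξ' Fib.∘ re₁ g' ξ))
      ≡⟨ ∘-cong refl (re-cong refl (∘-cong refl (re⁺ g' g ξ))) ⟨
    arr (ξ'' Fib.∘ re₁ g'' (ξ' Fib.∘ re₁⁺ g' g ξ))
      ≡⟨ ∘-cong refl (re⁺ g'' (g' ∘ g) _) ⟨
    arr (ξ'' Fib.∘ re₁⁺ g'' (g' ∘ g) (ξ' Fib.∘ re₁⁺ g' g ξ))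
      ∎
    where open ≡-Reasoning

-- The covariant Grothendieck construction.  The coercions ≡⇒Hom account for
-- A(id)x = x and A(g'g)x = A(g')A(g)x.

infixl 10 _⋄_
_⋄_ : (Γ : Category o h) → Ty Γ o₁ h₁ → Category (o ⊔ o₁) (h ⊔ h₁)
Γ ⋄ A = record
  { Ob    = Σ Γ.Ob λ γ → Fib.Ob {γ}
  ; Hom   = λ (γ , x) (γ' , x') → Σ[ g ∈ Γ.Hom γ γ' ] Fib.Hom (re₀ g x) x'
  ; id    = Γ.id , Fib.≡⇒Hom (re₀-id _)
  ; _∘_   = λ (g' , ξ') (g , ξ) → g' Γ.∘ g , ξ' Fib.∘ re₁⁺ g' g ξ
  ; idˡ   = λ (g , ξ) → pair (Γ.idˡ g) (begin
      arr (Fib.≡⇒Hom (re₀-id _) Fib.∘ re₁⁺ Γ.id g ξ)  ≡⟨ ≡⇒Hom-∘ (re₀-id _) _ ⟩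
      arr (re₁⁺ Γ.id g ξ)                              ≡⟨ re⁺ Γ.id g ξ ⟩
      arr (re₁ Γ.id ξ)                                 ≡⟨ re-id ξ ⟩
      arr ξ                                            ∎)
  ; idʳ   = λ (g , ξ) → pair (Γ.idʳ g) (begin
      arr (ξ Fib.∘ re₁⁺ g Γ.id (Fib.≡⇒Hom (re₀-id _)))
        ≡⟨ ∘-cong refl (re⁺ g Γ.id (Fib.≡⇒Hom (re₀-id _))) ⟩
      arr (ξ Fib.∘ re₁ g (Fib.≡⇒Hom (re₀-id _)))
        ≡⟨ ∘-cong refl (re-cong refl (≡⇒Hom-arr (re₀-id _))) ⟩
      arr (ξ Fib.∘ re₁ g Fib.id)
        ≡⟨ ∘-cong refl (cong arr (F-id (Re g))) ⟩
      arr (ξ Fib.∘ Fib.id)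
        ≡⟨ cong arr (Fib.idʳ ξ) ⟩
      arr ξ
        ∎)
  ; assoc = λ (g'' , ξ'') (g' , ξ') (g , ξ) → pair (Γ.assoc g'' g' g) (⊙-assoc g'' g' g ξ'' ξ' ξ)
  }
  where
  module Γ = Category Γ
  open Ty A
  open FibreArrows A
  open ≡-Reasoning

  pair : ∀ {γ γ'} {x : Fib.Ob {γ}} {x' : Fib.Ob {γ'}} {g k : Γ.Hom γ γ'}
           {ξ : Fib.Hom (re₀ g x) x'} {ζ : Fib.Hom (re₀ k x) x'} →
         g ≡ k → arr ξ ≡ arr ζ →
         _≡_ {A = Σ[ g ∈ Γ.Hom γ γ' ] Fib.Hom (re₀ g x) x'} (g , ξ) (k , ζ)
  pair refl p = cong (_ ,_) (arr⁻¹ p)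

wk : {Γ : Category o h} (A : Ty Γ o₁ h₁) → Functor (Γ ⋄ A) Γ
wk A = record { F₀ = proj₁ ; F₁ = proj₁ ; F-id = refl ; F-∘ = λ _ _ → refl }

-- Functors 𝒞ᵒᵖ × 𝒟 → Set, with the functor laws stated pointwise.

record Profunctor (𝒞 : Category o₁ h₁) (𝒟 : Category o₂ h₂) (ℓ : Level) :
                  Set (o₁ ⊔ h₁ ⊔ o₂ ⊔ h₂ ⊔ suc ℓ) where
  private
    module 𝒞 = Category 𝒞
    module 𝒟 = Category 𝒟
  field
    El       : 𝒞.Ob → 𝒟.Ob → Set ℓ
    dimap    : ∀ {x x' y y'} → 𝒞.Hom x' x → 𝒟.Hom y y' → El x y → El x' y'
    dimap-id : ∀ {x y} (u : El x y) → dimap 𝒞.id 𝒟.id u ≡ u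
    dimap-∘  : ∀ {x x' x'' y y' y''} (f : 𝒞.Hom x' x) (f' : 𝒞.Hom x'' x')
                 (k : 𝒟.Hom y y') (k' : 𝒟.Hom y' y'') (u : El x y) →
               dimap (f 𝒞.∘ f') (k' 𝒟.∘ k) u ≡ dimap f' k' (dimap f k u)

infix 4 _≗P_
record _≗P_ {𝒞 : Category o₁ h₁} {𝒟 : Category o₂ h₂} (P Q : Profunctor 𝒞 𝒟 ℓ) :
            Set (o₁ ⊔ h₁ ⊔ o₂ ⊔ h₂ ⊔ suc ℓ) where
  private
    module P = Profunctor P
    module Q = Profunctor Q
  field
    El-≡    : ∀ x y → P.El x y ≡ Q.El x y
    dimap-≅ : ∀ {x x' y y'} (f : Category.Hom 𝒞 x' x) (k : Category.Hom 𝒟 y y')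
              {u : P.El x y} {v : Q.El x y} → u ≅ v → P.dimap f k u ≅ Q.dimap f k v

Hom[_,_] : {𝒞 : Category o₁ h₁} {𝒟 : Category o₂ h₂} {ℰ : Category o₃ h₃} →
           Functor 𝒞 ℰ → Functor 𝒟 ℰ → Profunctor 𝒞 𝒟 h₃
Hom[_,_] {ℰ = ℰ} F G = record
  { El       = λ x y → Hom (F₀ F x) (F₀ G y)
  ; dimap    = λ f k u → F₁ G k ∘ (u ∘ F₁ F f)
  ; dimap-id = λ u → trans (cong₂ (λ a b → a ∘ (u ∘ b)) (F-id G) (F-id F)) (trans (idˡ _) (idʳ u))
  ; dimap-∘  = λ f f' k k' u → begin
      F₁ G _ ∘ (u ∘ F₁ F _)                              ≡⟨ cong₂ (λ a b → a ∘ (u ∘ b)) (F-∘ G k' k) (F-∘ F f f') ⟩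
      (F₁ G k' ∘ F₁ G k) ∘ (u ∘ (F₁ F f ∘ F₁ F f'))    ≡⟨ assoc _ _ _ ⟩
      F₁ G k' ∘ (F₁ G k ∘ (u ∘ (F₁ F f ∘ F₁ F f')))    ≡⟨ cong (λ a → F₁ G k' ∘ (F₁ G k ∘ a)) (assoc _ _ _) ⟨
      F₁ G k' ∘ (F₁ G k ∘ ((u ∘ F₁ F f) ∘ F₁ F f'))    ≡⟨ cong (F₁ G k' ∘_) (assoc _ _ _) ⟨
      F₁ G k' ∘ ((F₁ G k ∘ (u ∘ F₁ F f)) ∘ F₁ F f')    ∎
  }
  where
  open Category ℰ
  open ≡-Reasoning

-- The data and the laws of a normal lax functor from Γ (as a locally discrete
-- bicategory) to categories and profunctors.  A map out of a composite
-- profunctor, which is a coend, is a family _⊙_ satisfying the law dinatural;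
-- the unit constraint is the identity hom = D(id).

record RawTyᵈ (Γ : Category o h) (o₁ h₁ : Level) : Set (o ⊔ h ⊔ suc (o₁ ⊔ h₁)) where
  infixr 9 _⊙_
  open Category Γ
  field
    Fib  : Ob → Category o₁ h₁
    Prof : ∀ {γ γ'} → Hom γ γ' → Profunctor (Fib γ) (Fib γ') h₁

  module Fib {γ : Ob} = Category (Fib γ)
  module Prof {γ γ'} (g : Hom γ γ') = Profunctor (Prof g)

  field
    _⊙_ : ∀ {γ γ' γ''} {g' : Hom γ' γ''} {g : Hom γ γ'} {x y z} →
          Prof.El g' y z → Prof.El g x y → Prof.El (g' ∘ g) x z

record IsTyᵈ {Γ : Category o h} (D : RawTyᵈ Γ o₁ h₁) : Set (o ⊔ h ⊔ suc (o₁ ⊔ h₁)) where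
  open Category Γ using (Ob; Hom; id; _∘_)
  open RawTyᵈ D
  field
    normal    : ∀ γ → Prof (id {γ}) ≗P Hom[ idF , idF ]
    natural   : ∀ {γ γ' γ''} {g' : Hom γ' γ''} {g : Hom γ γ'} {x x' y z z'}
                  (f : Fib.Hom x' x) (k : Fib.Hom z z')
                  (v : Prof.El g' y z) (u : Prof.El g x y) →
                Prof.dimap (g' ∘ g) f k (v ⊙ u) ≡ Prof.dimap g' Fib.id k v ⊙ Prof.dimap g f Fib.id u
    dinatural : ∀ {γ γ' γ''} {g' : Hom γ' γ''} {g : Hom γ γ'} {x y y' z}
                  (k : Fib.Hom y y') (v : Prof.El g' y' z) (u : Prof.El g x y) →
                Prof.dimap g' k Fib.id v ⊙ u ≡ v ⊙ Prof.dimap g Fib.id k u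
    unitˡ     : ∀ {γ γ'} {g : Hom γ γ'} {x y y'}
                  (k : Fib.Hom y y') {v : Prof.El id y y'} → v ≅ k → (u : Prof.El g x y) →
                v ⊙ u ≅ Prof.dimap g Fib.id k u
    unitʳ     : ∀ {γ γ'} {g : Hom γ γ'} {x x' y}
                  (f : Fib.Hom x' x) {u : Prof.El id x' x} → u ≅ f → (v : Prof.El g x y) →
                v ⊙ u ≅ Prof.dimap g f Fib.id v
    assoc     : ∀ {γ γ' γ'' γ'''} {g'' : Hom γ'' γ'''} {g' : Hom γ' γ''} {g : Hom γ γ'} {w x y z}
                  (t : Prof.El g'' y z) (v : Prof.El g' x y) (u : Prof.El g w x) →
                (t ⊙ v) ⊙ u ≅ t ⊙ (v ⊙ u)

  unit : ∀ {γ} {x : Fib.Ob {γ}} → Prof.El id x x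
  unit {γ} {x} = subst (λ X → X) (sym (_≗P_.El-≡ (normal γ) x x)) Fib.id

  unit-≅ : ∀ {γ} {x : Fib.Ob {γ}} → unit ≅ Fib.id {γ} {x}
  unit-≅ {γ} {x} = ≡-subst-removable (λ X → X) (sym (_≗P_.El-≡ (normal γ) x x)) Fib.id

record Tyᵈ (Γ : Category o h) (o₁ h₁ : Level) : Set (o ⊔ h ⊔ suc (o₁ ⊔ h₁)) where
  constructor tyᵈ
  field
    raw   : RawTyᵈ Γ o₁ h₁
    isTyᵈ : IsTyᵈ raw

  open RawTyᵈ raw public
  open IsTyᵈ isTyᵈ public

-- Strict equality rather than equivalence, again unfolded pointwise; the laws of
-- IsTyᵈ are equations between elements of sets, so they need no comparison.

infix 4 _≗ᵈ_
record _≗ᵈ_ {Γ : Category o h} (D E : RawTyᵈ Γ o₁ h₁) : Set (o ⊔ h ⊔ suc (o₁ ⊔ h₁)) where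
  open Category Γ
  private
    module D = RawTyᵈ D
    module E = RawTyᵈ E
  field
    Fib-≡  : ∀ γ → D.Fib γ ≡ E.Fib γ
    Prof-≗ : ∀ {γ γ'} (g : Hom γ γ') →
             subst₂ (λ X Y → Profunctor X Y h₁) (Fib-≡ γ) (Fib-≡ γ') (D.Prof g) ≗P E.Prof g
    ⊙-≅    : ∀ {γ γ' γ''} {g' : Hom γ' γ''} {g : Hom γ γ'} {x y z x' y' z'} →
             x ≅ x' → y ≅ y' → z ≅ z' →
             {v : D.Prof.El g' y z} {v' : E.Prof.El g' y' z'} → v ≅ v' →
             {u : D.Prof.El g x y} {u' : E.Prof.El g x' y'} → u ≅ u' →
             v D.⊙ u ≅ v' E.⊙ u'

∫ : (Γ : Category o h) → Tyᵈ Γ o₁ h₁ → Category (o ⊔ o₁) (h ⊔ h₁)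
∫ Γ D = record
  { Ob    = Σ Γ.Ob λ γ → Fib.Ob {γ}
  ; Hom   = λ (γ , x) (γ' , x') → Σ[ g ∈ Γ.Hom γ γ' ] Prof.El g x x'
  ; id    = Γ.id , unit
  ; _∘_   = λ (g' , v) (g , u) → g' Γ.∘ g , v ⊙ u
  ; idˡ   = λ (g , u) → pair (Γ.idˡ g)
              (≅-trans (unitˡ Fib.id unit-≅ u) (≡-to-≅ (Prof.dimap-id g u)))
  ; idʳ   = λ (g , u) → pair (Γ.idʳ g)
              (≅-trans (unitʳ Fib.id unit-≅ u) (≡-to-≅ (Prof.dimap-id g u)))
  ; assoc = λ (g'' , t) (g' , v) (g , u) → pair (Γ.assoc g'' g' g) (assoc t v u)
  }
  where
  module Γ = Category Γ
  open Tyᵈ D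

  pair : ∀ {γ γ'} {x : Fib.Ob {γ}} {x' : Fib.Ob {γ'}} {g k : Γ.Hom γ γ'}
           {u : Prof.El g x x'} {v : Prof.El k x x'} →
         g ≡ k → u ≅ v →
         _≡_ {A = Σ[ g ∈ Γ.Hom γ γ' ] Prof.El g x x'} (g , u) (k , v)
  pair refl refl = refl

proj : {Γ : Category o h} (D : Tyᵈ Γ o₁ h₁) → Functor (∫ Γ D) Γ
proj D = record { F₀ = proj₁ ; F₁ = proj₁ ; F-id = refl ; F-∘ = λ _ _ → refl }

-- A(g) is regarded as the profunctor hom(A(g) -, -).

⌜_⌝ : {Γ : Category o h} → Ty Γ o₁ h₁ → Tyᵈ Γ o₁ h₁
⌜_⌝ {Γ = Γ} A = tyᵈ
  (record
    { Fib  = Fib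
    ; Prof = λ g → Hom[ Re g , idF ]
    ; _⊙_  = λ {_} {_} {_} {g'} {g} v u → v Fib.∘ re₁⁺ g' g u
    })
  (record
    { normal    = λ γ → record
        { El-≡    = λ x y → cong (λ x → Fib.Hom x y) (re₀-id x)
        ; dimap-≅ = λ f k u≅v → arr⇒≅ (∘-cong refl
                      (∘-cong (≅⇒arr (re₀-id _) refl u≅v) (re-id f)))
        }
    ; natural   = λ {_} {_} {_} {g'} {g} f k v u → arr⁻¹ (begin
        arr (k Fib.∘ ((v Fib.∘ re₁⁺ g' g u) Fib.∘ re₁ (g' ∘ g) f))
          ≡⟨ ∘-cong refl (∘-cong (∘-cong refl (re⁺ g' g u)) (re-∘ g' g f)) ⟩
        arr (k Fib.∘ ((v Fib.∘ re₁ g' u) Fib.∘ re₁ g' (re₁ g f)))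
          ≡⟨ ∘-cong refl (cong arr (Fib.assoc _ _ _)) ⟩
        arr (k Fib.∘ (v Fib.∘ (re₁ g' u Fib.∘ re₁ g' (re₁ g f))))
          ≡⟨ cong arr (Fib.assoc _ _ _) ⟨
        arr ((k Fib.∘ v) Fib.∘ (re₁ g' u Fib.∘ re₁ g' (re₁ g f)))
          ≡⟨ ∘-cong (∘-cong refl (∘-re-id v)) (cong arr (F-∘ (Re g') _ _)) ⟨
        arr ((k Fib.∘ (v Fib.∘ re₁ g' Fib.id)) Fib.∘ re₁ g' (u Fib.∘ re₁ g f))
          ≡⟨ ∘-cong refl (re-cong refl (cong arr (Fib.idˡ _))) ⟨
        arr ((k Fib.∘ (v Fib.∘ re₁ g' Fib.id)) Fib.∘ re₁ g' (Fib.id Fib.∘ (u Fib.∘ re₁ g f)))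
          ≡⟨ ∘-cong refl (re⁺ g' g _) ⟨
        arr ((k Fib.∘ (v Fib.∘ re₁ g' Fib.id)) Fib.∘ re₁⁺ g' g (Fib.id Fib.∘ (u Fib.∘ re₁ g f)))
          ∎)
    ; dinatural = λ {_} {_} {_} {g'} {g} k v u → arr⁻¹ (begin
        arr ((Fib.id Fib.∘ (v Fib.∘ re₁ g' k)) Fib.∘ re₁⁺ g' g u)
          ≡⟨ ∘-cong (cong arr (Fib.idˡ _)) (re⁺ g' g u) ⟩
        arr ((v Fib.∘ re₁ g' k) Fib.∘ re₁ g' u)
          ≡⟨ cong arr (Fib.assoc _ _ _) ⟩
        arr (v Fib.∘ (re₁ g' k Fib.∘ re₁ g' u))
          ≡⟨ ∘-cong refl (cong arr (F-∘ (Re g') _ _)) ⟨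
        arr (v Fib.∘ re₁ g' (k Fib.∘ u))
          ≡⟨ ∘-cong refl (re-cong refl (∘-cong refl (∘-re-id u))) ⟨
        arr (v Fib.∘ re₁ g' (k Fib.∘ (u Fib.∘ re₁ g Fib.id)))
          ≡⟨ ∘-cong refl (re⁺ g' g _) ⟨
        arr (v Fib.∘ re₁⁺ g' g (k Fib.∘ (u Fib.∘ re₁ g Fib.id)))
          ∎)
    ; unitˡ     = λ {_} {_} {g} k {v} v≅k u → arr⇒≅ (begin
        arr (v Fib.∘ re₁⁺ id g u)
          ≡⟨ ∘-cong (≅⇒arr (re₀-id _) refl v≅k) (trans (re⁺ id g u) (re-id u)) ⟩
        arr (k Fib.∘ u)
          ≡⟨ ∘-cong refl (∘-re-id u) ⟨
        arr (k Fib.∘ (u Fib.∘ re₁ g Fib.id))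
          ∎)
    ; unitʳ     = λ {_} {_} {g} f {u} u≅f v → arr⇒≅ (begin
        arr (v Fib.∘ re₁⁺ g id u)
          ≡⟨ ∘-cong refl (trans (re⁺ g id u) (re-cong refl (≅⇒arr (re₀-id _) refl u≅f))) ⟩
        arr (v Fib.∘ re₁ g f)
          ≡⟨ cong arr (Fib.idˡ _) ⟨
        arr (Fib.id Fib.∘ (v Fib.∘ re₁ g f))
          ∎)
    ; assoc     = λ {_} {_} {_} {_} {g''} {g'} {g} t v u → arr⇒≅ (⊙-assoc g'' g' g t v u)
    })
  where
  open Category Γ using (id; _∘_)
  open Ty A
  open FibreArrows A
  open ≡-Reasoning

  ∘-re-id : ∀ {γ γ'} {g : Category.Hom Γ γ γ'} {x : Fib.Ob} {y : Fib.Ob} (u : Fib.Hom (re₀ g x) y) →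
            arr (u Fib.∘ re₁ g Fib.id) ≡ arr u
  ∘-re-id {g = g} u = cong arr (trans (cong (u Fib.∘_) (F-id (Re g))) (Fib.idʳ u))

module Twist {Γ : Category o h} (B : Ty Γ o₁ h₁) (C : Ty (Γ ⋄ B ᵒᵖ) o₂ h₂) where
  private
    module Γ = Category Γ
    module T = Category (Γ ⋄ B)
    module P = Category (Γ ⋄ B ᵒᵖ)
    module B = Ty B
    module C = Ty C
    module ΓA = Arrows Γ
    module PA = Arrows (Γ ⋄ B ᵒᵖ)
    module BA = FibreArrows B
    module BopA = FibreArrows (B ᵒᵖ)
    module CA = FibreArrows C
    open ≡-Reasoning

  -- The morphism (id, β), with B(id)b' = b' made explicit; in the fibres of
  -- B ᵒᵖ it points from b' to b.

  vert : ∀ {γ} {b b' : B.Fib.Ob {γ}} → B.Fib.Hom b b' → P.Hom (γ , b') (γ , b)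
  vert β = Γ.id , B.Fib.≡⇒Hom (sym (B.re₀-id _)) B.Fib.∘ β

  left : ∀ {γ γ'} {b : B.Fib.Ob {γ}} (g : Γ.Hom γ γ') → P.Hom (γ , b) (γ' , B.re₀ g b)
  left g = g , B.Fib.id

  right : ∀ {γ b γ' b'} ((g , β) : T.Hom (γ , b) (γ' , b')) → P.Hom (γ' , b') (γ' , B.re₀ g b)
  right (g , β) = vert β

  -- Composing (g', β') with (g, β): reindexing along push carries
  -- hom(C(g, id)c, C(id, β)c') to the fibre over (γ'', B(g'g)b), and
  -- reindexing along pull does so for hom(C(g', id)c', C(id, β')c'').

  push : ∀ {γ b γ' γ''} (g' : Γ.Hom γ' γ'') (g : Γ.Hom γ γ') →
         P.Hom (γ' , B.re₀ g b) (γ'' , B.re₀ (g' Γ.∘ g) b)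
  push g' g = g' , B.Fib.≡⇒Hom (B.re₀-∘ g' g _)

  pull : ∀ {γ b γ' b' γ''} (g' : Γ.Hom γ' γ'') ((g , β) : T.Hom (γ , b) (γ' , b')) →
         P.Hom (γ'' , B.re₀ g' b') (γ'' , B.re₀ (g' Γ.∘ g) b)
  pull g' (g , β) = vert (B.re₁⁺ g' g β)

  vertA : ∀ {γ} {b b' : B.Fib.Ob {γ}} (β : B.Fib.Hom b b') → BA.arr (proj₂ (vert β)) ≡ BA.arr β
  vertA β = BA.≡⇒Hom-∘ (sym (B.re₀-id _)) β

  unop : ∀ {γ γ'} {x y : B.Fib.Ob {γ}} {x' y' : B.Fib.Ob {γ'}}
           {f : B.Fib.Hom y x} {f' : B.Fib.Hom y' x'} →
         BopA.arr f ≡ BopA.arr f' → BA.arr f ≡ BA.arr f'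
  unop refl = refl

  idA : ∀ {γ b} → BA.arr (proj₂ (P.id {γ , b})) ≡ BA.arr (B.Fib.id {x = b})
  idA = unop (BopA.≡⇒Hom-arr (B.re₀-id _))

  ∘A : ∀ {γ b γ' b' γ'' b''} ((g' , ξ') : P.Hom (γ' , b') (γ'' , b''))
         ((g , ξ) : P.Hom (γ , b) (γ' , b')) →
       BA.arr (proj₂ ((g' , ξ') P.∘ (g , ξ))) ≡ BA.arr (B.re₁ g' ξ B.Fib.∘ ξ')
  ∘A (g' , ξ') (g , ξ) = BA.∘-cong (unop (BopA.re⁺ g' g ξ)) refl

  arrP : ∀ {γ b γ' b' δ' d'} {g : Γ.Hom γ γ'} {k : Γ.Hom γ δ'}
           {ξ : B.Fib.Hom b' (B.re₀ g b)} {ζ : B.Fib.Hom d' (B.re₀ k b)} →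
         ΓA.arr g ≡ ΓA.arr k → BA.arr ξ ≡ BA.arr ζ →
         PA.arr {γ , b} {γ' , b'} (g , ξ) ≡ PA.arr {γ , b} {δ' , d'} (k , ζ)
  arrP refl refl = refl

  push-left : ∀ {γ b γ' γ''} (g' : Γ.Hom γ' γ'') (g : Γ.Hom γ γ') →
              push g' g P.∘ left {b = b} g ≡ left (g' Γ.∘ g)
  push-left g' g = PA.arr⁻¹ (arrP refl (begin
    _                ≡⟨ ∘A (push g' g) (left g) ⟩
    _                ≡⟨ BA.absorbˡ (BA.re-pres-id g') ⟩
    BA.arr (proj₂ (push g' g))  ≡⟨ BA.≡⇒Hom-arr (B.re₀-∘ g' g _) ⟩
    BA.arr B.Fib.id  ≡⟨ BA.id-arr (cong (_ ,_) (B.re₀-∘ g' g _)) ⟨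
    BA.arr B.Fib.id  ∎))

  push-right : ∀ {γ b γ' b' γ''} (g' : Γ.Hom γ' γ'') (a : T.Hom (γ , b) (γ' , b')) →
               push g' (proj₁ a) P.∘ right a ≡ pull g' a P.∘ left g'
  push-right g' a@(g , β) = PA.arr⁻¹ (arrP (cong ΓA.arr (trans (Γ.idʳ g') (sym (Γ.idˡ g')))) (begin
    _                          ≡⟨ ∘A (push g' g) (right a) ⟩
    _                          ≡⟨ BA.absorbʳ (BA.≡⇒Hom-arr (B.re₀-∘ g' g _)) ⟩
    BA.arr (B.re₁ g' (proj₂ (right a)))  ≡⟨ BA.re-cong refl (vertA β) ⟩
    BA.arr (B.re₁ g' β)        ≡⟨ BA.re⁺ g' g β ⟨
    BA.arr (B.re₁⁺ g' g β)     ≡⟨ vertA _ ⟨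
    BA.arr (proj₂ (pull g' a)) ≡⟨ BA.absorbˡ (BA.re-pres-id Γ.id) ⟨
    _                          ≡⟨ ∘A (pull g' a) (left g') ⟨
    _                          ∎))

  pull-right : ∀ {γ b γ' b' γ'' b''} (a' : T.Hom (γ' , b') (γ'' , b'')) (a : T.Hom (γ , b) (γ' , b')) →
               pull (proj₁ a') a P.∘ right a' ≡ right (a' T.∘ a)
  pull-right a'@(g' , β') a@(g , β) = PA.arr⁻¹ (arrP (cong ΓA.arr (Γ.idˡ Γ.id)) (begin
    _                                       ≡⟨ ∘A (pull g' a) (right a') ⟩
    _                                       ≡⟨ BA.∘-cong (trans (BA.re-id _) (vertA β')) (vertA _) ⟩
    BA.arr (β' B.Fib.∘ B.re₁⁺ g' g β)       ≡⟨ vertA _ ⟨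
    _                                       ∎))

  left-id : ∀ {γ b} → left {γ} {γ} {b} Γ.id ≡ right T.id
  left-id = PA.arr⁻¹ (arrP refl (begin
    BA.arr B.Fib.id                       ≡⟨ BA.id-arr (cong (_ ,_) (B.re₀-id _)) ⟩
    BA.arr B.Fib.id                       ≡⟨ BA.≡⇒Hom-arr (B.re₀-id _) ⟨
    BA.arr (B.Fib.≡⇒Hom (B.re₀-id _))    ≡⟨ vertA _ ⟨
    _                                     ∎))

  Θ : ∀ {γ b γ' b'} → T.Hom (γ , b) (γ' , b') → C.Fib.Ob {γ , b} → C.Fib.Ob {γ' , b'} → Set h₂
  Θ a c c' = C.Fib.Hom (C.re₀ (left (proj₁ a)) c) (C.re₀ (right a) c')

  re₀-≡ : ∀ {p q r} {k : P.Hom q r} {l : P.Hom p q} {m : P.Hom p r} →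
          k P.∘ l ≡ m → (c : C.Fib.Ob) → C.re₀ k (C.re₀ l c) ≡ C.re₀ m c
  re₀-≡ refl c = sym (C.re₀-∘ _ _ c)

  module _ {γ b γ' b' γ'' b''} (a' : T.Hom (γ' , b') (γ'' , b'')) (a : T.Hom (γ , b) (γ' , b')) where
    private
      g' = proj₁ a'
      g  = proj₁ a

    pulled : ∀ {c' : C.Fib.Ob} {c'' : C.Fib.Ob} → Θ a' c' c'' →
             C.Fib.Hom (C.re₀ (pull g' a) (C.re₀ (left g') c')) (C.re₀ (right (a' T.∘ a)) c'')
    pulled θ' = C.Fib.≡⇒Hom (re₀-≡ (pull-right a' a) _) C.Fib.∘ C.re₁ (pull g' a) θ'

    pushed : ∀ {c : C.Fib.Ob} {c' : C.Fib.Ob} → Θ a c c' →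
             C.Fib.Hom (C.re₀ (left (g' Γ.∘ g)) c) (C.re₀ (pull g' a) (C.re₀ (left g') c'))
    pushed θ = (C.Fib.≡⇒Hom (trans (re₀-≡ (push-right g' a) _) (C.re₀-∘ (pull g' a) (left g') _))
                C.Fib.∘ C.re₁ (push g' g) θ)
               C.Fib.∘ C.Fib.≡⇒Hom (sym (re₀-≡ (push-left g' g) _))

    pulledA : ∀ {c' : C.Fib.Ob} {c'' : C.Fib.Ob} (θ' : Θ a' c' c'') →
              CA.arr (pulled θ') ≡ CA.arr (C.re₁ (pull g' a) θ')
    pulledA θ' = CA.≡⇒Hom-∘ (re₀-≡ (pull-right a' a) _) _

    pushedA : ∀ {c : C.Fib.Ob} {c' : C.Fib.Ob} (θ : Θ a c c') →
              CA.arr (pushed θ) ≡ CA.arr (C.re₁ (push g' g) θ)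
    pushedA θ = trans (CA.∘-≡⇒Hom _ (sym (re₀-≡ (push-left g' g) _)))
      (CA.≡⇒Hom-∘ (trans (re₀-≡ (push-right g' a) _) (C.re₀-∘ (pull g' a) (left g') _)) _)

    comp : ∀ {c : C.Fib.Ob} {c' : C.Fib.Ob} {c'' : C.Fib.Ob} →
           Θ a' c' c'' → Θ a c c' → Θ (a' T.∘ a) c c''
    comp θ' θ = pulled θ' C.Fib.∘ pushed θ

  twist-id : ∀ {γ b} {c : C.Fib.Ob {γ , b}} → Θ T.id c c
  twist-id {c = c} = C.Fib.≡⇒Hom (cong (λ r → C.re₀ r c) left-id)

  push-id : ∀ {γ b γ'} (g : Γ.Hom γ γ') →
            PA.arr (push {b = b} Γ.id g) ≡ PA.arr (P.id {γ' , B.re₀ g b})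
  push-id g = arrP refl (begin
    _                ≡⟨ BA.≡⇒Hom-arr (B.re₀-∘ Γ.id g _) ⟩
    BA.arr B.Fib.id  ≡⟨ BA.id-arr (cong (_ ,_) (B.re₀-id _)) ⟩
    BA.arr B.Fib.id  ≡⟨ idA ⟨
    _                ∎)

  pull-id : ∀ {γ b γ'} (g : Γ.Hom γ γ') →
            PA.arr (pull g (T.id {γ , b})) ≡ PA.arr (P.id {γ' , B.re₀ g b})
  pull-id g = arrP refl (begin
    _                                        ≡⟨ vertA _ ⟩
    BA.arr (B.re₁⁺ g Γ.id (proj₂ T.id))     ≡⟨ BA.re⁺ g Γ.id _ ⟩
    BA.arr (B.re₁ g (proj₂ T.id))            ≡⟨ BA.re-cong refl (BA.≡⇒Hom-arr (B.re₀-id _)) ⟩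
    BA.arr (B.re₁ g B.Fib.id)                ≡⟨ BA.re-pres-id g ⟩
    BA.arr B.Fib.id                          ≡⟨ idA ⟨
    _                                        ∎)

  module _ {γ b γ' b' γ'' b'' γ''' b'''} (a'' : T.Hom (γ'' , b'') (γ''' , b'''))
           (a' : T.Hom (γ' , b') (γ'' , b'')) (a : T.Hom (γ , b) (γ' , b')) where
    private
      g''  = proj₁ a''
      g'   = proj₁ a'
      g    = proj₁ a
      g''' = g'' Γ.∘ g'

    pull-pull : PA.arr (pull g''' a P.∘ pull g'' a') ≡ PA.arr (pull g'' (a' T.∘ a))
    pull-pull = arrP (cong ΓA.arr (Γ.idˡ _)) (begin
      _ ≡⟨ ∘A (pull g''' a) (pull g'' a') ⟩
      _ ≡⟨ BA.∘-cong (trans (BA.re-id _) (trans (vertA _) (BA.re⁺ g'' g' _)))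
                     (trans (vertA _) (trans (BA.re⁺ g''' g _) (BA.re-∘ g'' g' _))) ⟩
      BA.arr (B.re₁ g'' (proj₂ a') B.Fib.∘ B.re₁ g'' (B.re₁ g' (proj₂ a)))
        ≡⟨ cong BA.arr (F-∘ (B.Re g'') _ _) ⟨
      BA.arr (B.re₁ g'' (proj₂ a' B.Fib.∘ B.re₁ g' (proj₂ a)))
        ≡⟨ BA.re-cong refl (BA.∘-cong refl (BA.re⁺ g' g _)) ⟨
      BA.arr (B.re₁ g'' (proj₂ (a' T.∘ a)))
        ≡⟨ trans (vertA _) (BA.re⁺ g'' (g' Γ.∘ g) _) ⟨
      _ ∎)

    pull-push : PA.arr (pull g''' a P.∘ push g'' g') ≡ PA.arr (push g'' (g' Γ.∘ g) P.∘ pull g' a)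
    pull-push = arrP (cong ΓA.arr (trans (Γ.idˡ _) (sym (Γ.idʳ _)))) (begin
      _ ≡⟨ ∘A (pull g''' a) (push g'' g') ⟩
      _ ≡⟨ BA.absorbˡ (trans (BA.re-id _) (BA.≡⇒Hom-arr (B.re₀-∘ g'' g' _))) ⟩
      _ ≡⟨ trans (vertA _) (trans (BA.re⁺ g''' g _) (BA.re-∘ g'' g' _)) ⟩
      BA.arr (B.re₁ g'' (B.re₁ g' (proj₂ a)))
        ≡⟨ BA.re-cong refl (trans (vertA _) (BA.re⁺ g' g _)) ⟨
      BA.arr (B.re₁ g'' (proj₂ (pull g' a)))
        ≡⟨ BA.absorbʳ (BA.≡⇒Hom-arr (B.re₀-∘ g'' (g' Γ.∘ g) _)) ⟨
      _ ≡⟨ ∘A (push g'' (g' Γ.∘ g)) (pull g' a) ⟨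
      _ ∎)

    push-push : PA.arr (push {b = b} g''' g) ≡ PA.arr (push g'' (g' Γ.∘ g) P.∘ push g' g)
    push-push = arrP refl (begin
      _               ≡⟨ BA.≡⇒Hom-arr (B.re₀-∘ g''' g _) ⟩
      BA.arr B.Fib.id ≡⟨ BA.id-arr (cong (_ ,_) (B.re₀-∘ g'' g' _)) ⟩
      BA.arr B.Fib.id ≡⟨ BA.id-arr (cong (_ ,_) (cong (B.re₀ g'') (B.re₀-∘ g' g _))) ⟨
      BA.arr B.Fib.id ≡⟨ BA.re-pres-id g'' ⟨
      BA.arr (B.re₁ g'' B.Fib.id)
        ≡⟨ BA.re-cong refl (trans (BA.≡⇒Hom-arr (B.re₀-∘ g' g _))
             (BA.id-arr (cong (_ ,_) (sym (B.re₀-∘ g' g _))))) ⟨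
      BA.arr (B.re₁ g'' (proj₂ (push g' g)))
        ≡⟨ BA.absorbʳ (BA.≡⇒Hom-arr (B.re₀-∘ g'' (g' Γ.∘ g) _)) ⟨
      _ ≡⟨ ∘A (push g'' (g' Γ.∘ g)) (push g' g) ⟨
      _ ∎)

  twist : RawTyᵈ (Γ ⋄ B) o₂ h₂
  twist = record
    { Fib  = C.Fib
    ; Prof = λ a → Hom[ C.Re (left (proj₁ a)) , C.Re (right a) ]
    ; _⊙_  = λ {_} {_} {_} {a'} {a} → comp a' a
    }

  comp-idˡ : ∀ {γ b γ' b'} (a : T.Hom (γ , b) (γ' , b')) {c : C.Fib.Ob} {c' : C.Fib.Ob}
             (θ : Θ a c c') → CA.arr (comp T.id a twist-id θ) ≡ CA.arr θ
  comp-idˡ a θ = begin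
    CA.arr (comp T.id a twist-id θ)
      ≡⟨ CA.absorbˡ (trans (pulledA T.id a twist-id)
           (trans (CA.re-cong refl (CA.≡⇒Hom-arr (cong (λ r → C.re₀ r _) left-id)))
                  (CA.re-pres-id (pull Γ.id a)))) ⟩
    CA.arr (pushed T.id a θ)                     ≡⟨ pushedA T.id a θ ⟩
    CA.arr (C.re₁ (push Γ.id (proj₁ a)) θ)      ≡⟨ CA.re-≡id θ (push-id (proj₁ a)) ⟩
    CA.arr θ                                     ∎

  comp-idʳ : ∀ {γ b γ' b'} (a : T.Hom (γ , b) (γ' , b')) {c : C.Fib.Ob} {c' : C.Fib.Ob}
             (θ : Θ a c c') → CA.arr (comp a T.id θ twist-id) ≡ CA.arr θ
  comp-idʳ a θ = begin
    CA.arr (comp a T.id θ twist-id)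
      ≡⟨ CA.absorbʳ (trans (pushedA a T.id twist-id)
           (trans (CA.re-cong refl (CA.≡⇒Hom-arr (cong (λ r → C.re₀ r _) left-id)))
                  (CA.re-pres-id (push (proj₁ a) Γ.id)))) ⟩
    CA.arr (pulled a T.id θ)                     ≡⟨ pulledA a T.id θ ⟩
    CA.arr (C.re₁ (pull (proj₁ a) T.id) θ)      ≡⟨ CA.re-≡id θ (pull-id (proj₁ a)) ⟩
    CA.arr θ                                     ∎

  comp-assoc : ∀ {γ b γ' b' γ'' b'' γ''' b'''} (a'' : T.Hom (γ'' , b'') (γ''' , b'''))
                 (a' : T.Hom (γ' , b') (γ'' , b'')) (a : T.Hom (γ , b) (γ' , b'))
                 {c : C.Fib.Ob} {c' : C.Fib.Ob} {c'' : C.Fib.Ob} {c''' : C.Fib.Ob}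
                 (θ'' : Θ a'' c'' c''') (θ' : Θ a' c' c'') (θ : Θ a c c') →
               CA.arr (comp (a'' T.∘ a') a (comp a'' a' θ'' θ') θ) ≡
               CA.arr (comp a'' (a' T.∘ a) θ'' (comp a' a θ' θ))
  comp-assoc a'' a' a θ'' θ' θ = begin
    CA.arr (pulled (a'' T.∘ a') a (comp a'' a' θ'' θ') C.Fib.∘ pushed (a'' T.∘ a') a θ)
      ≡⟨ CA.∘-cong (trans (pulledA (a'' T.∘ a') a _) (cong CA.arr (F-∘ (C.Re M) _ _))) refl ⟩
    CA.arr ((C.re₁ M (pulled a'' a' θ'') C.Fib.∘ C.re₁ M (pushed a'' a' θ')) C.Fib.∘
            pushed (a'' T.∘ a') a θ)
      ≡⟨ cong CA.arr (C.Fib.assoc _ _ _) ⟩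
    CA.arr (C.re₁ M (pulled a'' a' θ'') C.Fib.∘
            (C.re₁ M (pushed a'' a' θ') C.Fib.∘ pushed (a'' T.∘ a') a θ))
      ≡⟨ CA.∘-cong pull∘pull (trans (CA.∘-cong pull∘push push∘push)
           (sym (trans (pushedA a'' (a' T.∘ a) _) (cong CA.arr (F-∘ (C.Re K) _ _))))) ⟩
    CA.arr (pulled a'' (a' T.∘ a) θ'' C.Fib.∘ pushed a'' (a' T.∘ a) (comp a' a θ' θ))
      ∎
    where
    M = pull (proj₁ (a'' T.∘ a')) a
    K = push (proj₁ a'') (proj₁ (a' T.∘ a))
    m = pull (proj₁ a'') a'
    k = push (proj₁ a'') (proj₁ a')
    m' = pull (proj₁ a') a
    k' = push (proj₁ a') (proj₁ a)

    pull∘pull : CA.arr (C.re₁ M (pulled a'' a' θ'')) ≡ CA.arr (pulled a'' (a' T.∘ a) θ'')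
    pull∘pull = begin
      CA.arr (C.re₁ M (pulled a'' a' θ''))             ≡⟨ CA.re-cong refl (pulledA a'' a' θ'') ⟩
      CA.arr (C.re₁ M (C.re₁ m θ''))                   ≡⟨ CA.re-∘ M m θ'' ⟨
      CA.arr (C.re₁ (M P.∘ m) θ'')                     ≡⟨ CA.re-cong (pull-pull a'' a' a) refl ⟩
      CA.arr (C.re₁ (pull (proj₁ a'') (a' T.∘ a)) θ'') ≡⟨ pulledA a'' (a' T.∘ a) θ'' ⟨
      CA.arr (pulled a'' (a' T.∘ a) θ'')               ∎

    pull∘push : CA.arr (C.re₁ M (pushed a'' a' θ')) ≡ CA.arr (C.re₁ K (pulled a' a θ'))
    pull∘push = begin
      CA.arr (C.re₁ M (pushed a'' a' θ'))  ≡⟨ CA.re-cong refl (pushedA a'' a' θ') ⟩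
      CA.arr (C.re₁ M (C.re₁ k θ'))        ≡⟨ CA.re-∘ M k θ' ⟨
      CA.arr (C.re₁ (M P.∘ k) θ')          ≡⟨ CA.re-cong (pull-push a'' a' a) refl ⟩
      CA.arr (C.re₁ (K P.∘ m') θ')         ≡⟨ CA.re-∘ K m' θ' ⟩
      CA.arr (C.re₁ K (C.re₁ m' θ'))       ≡⟨ CA.re-cong refl (pulledA a' a θ') ⟨
      CA.arr (C.re₁ K (pulled a' a θ'))    ∎

    push∘push : CA.arr (pushed (a'' T.∘ a') a θ) ≡ CA.arr (C.re₁ K (pushed a' a θ))
    push∘push = begin
      CA.arr (pushed (a'' T.∘ a') a θ)  ≡⟨ pushedA (a'' T.∘ a') a θ ⟩
      CA.arr (C.re₁ (push (proj₁ (a'' T.∘ a')) (proj₁ a)) θ)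
                                         ≡⟨ CA.re-cong (push-push a'' a' a) refl ⟩
      CA.arr (C.re₁ (K P.∘ k') θ)       ≡⟨ CA.re-∘ K k' θ ⟩
      CA.arr (C.re₁ K (C.re₁ k' θ))     ≡⟨ CA.re-cong refl (pushedA a' a θ) ⟨
      CA.arr (C.re₁ K (pushed a' a θ))  ∎

  total : Category (o ⊔ o₁ ⊔ o₂) (h ⊔ h₁ ⊔ h₂)
  total = record
    { Ob    = Σ[ γ ∈ Γ.Ob ] Σ[ b ∈ B.Fib.Ob {γ} ] C.Fib.Ob {γ , b}
    ; Hom   = λ (γ , b , c) (γ' , b' , c') →
                Σ[ g ∈ Γ.Hom γ γ' ] Σ[ β ∈ B.Fib.Hom (B.re₀ g b) b' ] Θ (g , β) c c'
    ; id    = Γ.id , B.Fib.≡⇒Hom (B.re₀-id _) , twist-id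
    ; _∘_   = λ (g' , β' , θ') (g , β , θ) →
                let a' = g' , β' ; a = g , β in
                proj₁ (a' T.∘ a) , proj₂ (a' T.∘ a) , comp a' a θ' θ
    ; idˡ   = λ (g , β , θ) → triple (T.idˡ (g , β)) (comp-idˡ (g , β) θ)
    ; idʳ   = λ (g , β , θ) → triple (T.idʳ (g , β)) (comp-idʳ (g , β) θ)
    ; assoc = λ (g'' , β'' , θ'') (g' , β' , θ') (g , β , θ) →
                triple (T.assoc (g'' , β'') (g' , β') (g , β))
                       (comp-assoc (g'' , β'') (g' , β') (g , β) θ'' θ' θ)
    }
    where
    triple : ∀ {γ b γ' b'} {c : C.Fib.Ob} {c' : C.Fib.Ob} {a a' : T.Hom (γ , b) (γ' , b')}
               {θ : Θ a c c'} {θ' : Θ a' c c'} → a ≡ a' → CA.arr θ ≡ CA.arr θ' →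
             _≡_ {A = Σ[ g ∈ Γ.Hom γ γ' ] Σ[ β ∈ B.Fib.Hom (B.re₀ g b) b' ] Θ (g , β) c c'}
                 (proj₁ a , proj₂ a , θ) (proj₁ a' , proj₂ a' , θ')
    triple refl p = cong (λ θ → _ , _ , θ) (CA.arr⁻¹ p)

  projection : Functor total (Γ ⋄ B)
  projection = record
    { F₀   = λ (γ , b , c) → γ , b
    ; F₁   = λ (g , β , θ) → g , β
    ; F-id = refl
    ; F-∘  = λ _ _ → refl
    }

Tw : {Γ : Category o h} (B : Ty Γ o₁ h₁) → Ty (Γ ⋄ B ᵒᵖ) o₂ h₂ → RawTyᵈ (Γ ⋄ B) o₂ h₂
Tw = Twist.twist

infixl 10 _⋄⟨_⋉_⟩
_⋄⟨_⋉_⟩ : (Γ : Category o h) (B : Ty Γ o₁ h₁) → Ty (Γ ⋄ B ᵒᵖ) o₂ h₂ →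
          Category (o ⊔ o₁ ⊔ o₂) (h ⊔ h₁ ⊔ h₂)
Γ ⋄⟨ B ⋉ C ⟩ = Twist.total B C

π₂ : {Γ : Category o h} (B : Ty Γ o₁ h₁) (C : Ty (Γ ⋄ B ᵒᵖ) o₂ h₂) →
     Functor (Γ ⋄⟨ B ⋉ C ⟩) (Γ ⋄ B)
π₂ = Twist.projection

{-# OPTIONS --safe #-}
module Submission where

open import Level using (Level)
open import Data.Product using (Σ-syntax; _×_; _,_; proj₁)
open import Relation.Binary.PropositionalEquality
  using (_≡_; refl; sym; trans; cong; cong₂; module ≡-Reasoning)
open import Relation.Binary.HeterogeneousEquality using (_≅_; refl)
open import Defs

-- Reindexing along push and pull puts a composite of the twist into a single
-- fibre of C, where every law follows from functoriality of C; the compatibility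
-- of the two halves is the equation push-right.  Over the identity of (γ, b) the
-- morphisms left and right are identities up to B(id)b = b, whence normality.
-- If C does not depend on b, then reindexing along right and pull is C(id), hence
-- trivial, and only C(g) is left.

private
  variable
    o h o₁ h₁ o₂ h₂ : Level

-- Reindexing along identities up to endpoints.

module _ {Γ : Category o h} (A : Ty Γ o₁ h₁) where
  open Category Γ
  open Ty A
  open FibreArrows A
  private module Γ = Arrows Γ

  -- `k` and `l` stand for `left` and `right` of an identity, with codomain `(γ , B(id)b)`. This
  -- equals `(γ , b)` only propositionally, so being an identity is an equation in `Arr`.
  Hom-re-≡id : ∀ {γ γ' δ} {k l : Hom γ γ'} → k ≡ l → Γ.arr k ≡ Γ.arr (id {δ}) →
               (x y : Fib.Ob {γ}) → Fib.Hom (re₀ k x) (re₀ l y) ≡ Fib.Hom x y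
  Hom-re-≡id refl refl x y = cong₂ Fib.Hom (re₀-id x) (re₀-id y)

  -- A heterogeneous equation between morphisms does not determine their endpoints; `re₀-id`
  -- supplies these.
  ≅-re-≡id⇒arr : ∀ {γ γ' δ} {k l : Hom γ γ'} → k ≡ l → Γ.arr k ≡ Γ.arr (id {δ}) →
                 ∀ {x y : Fib.Ob {γ}} {v : Fib.Hom (re₀ k x) (re₀ l y)} {f : Fib.Hom x y} →
                 v ≅ f → arr v ≡ arr f
  ≅-re-≡id⇒arr refl refl = ≅⇒arr (re₀-id _) (re₀-id _)

-- The twist as a normal lax functor.

module TwistLaws {Γ : Category o h} (B : Ty Γ o₁ h₁) (C : Ty (Γ ⋄ B ᵒᵖ) o₂ h₂) where
  open Twist B C
  private
    module Γ = Category Γ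
    module T = Category (Γ ⋄ B)
    module P = Category (Γ ⋄ B ᵒᵖ)
    module B = Ty B
    module C = Ty C
    module PA = Arrows (Γ ⋄ B ᵒᵖ)
    module BA = FibreArrows B
  open FibreArrows C
  open ≡-Reasoning

  left-≡id : ∀ {γ b} → PA.arr (left {b = b} (Γ.id {γ})) ≡ PA.arr (P.id {γ , b})
  left-≡id = arrP refl (trans (BA.id-arr (cong (_ ,_) (B.re₀-id _))) (sym idA))

  right-≡id : ∀ {γ b} → PA.arr (right (T.id {γ , b})) ≡ PA.arr (P.id {γ , b})
  right-≡id = trans (cong PA.arr (sym left-id)) left-≡id

  Θ-id⇒arr : ∀ {γ b} {c c' : C.Fib.Ob {γ , b}} {v : Θ T.id c c'} {f : C.Fib.Hom c c'} →
             v ≅ f → arr v ≡ arr f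
  Θ-id⇒arr = ≅-re-≡id⇒arr C left-id left-≡id

  twist-id-arr : ∀ {γ b} {c : C.Fib.Ob {γ , b}} → arr (twist-id {c = c}) ≡ arr (C.Fib.id {x = c})
  twist-id-arr {c = c} = begin
    arr twist-id                        ≡⟨ ≡⇒Hom-arr (cong (λ r → C.re₀ r c) left-id) ⟩
    arr C.Fib.id                        ≡⟨ re-pres-id (right T.id) ⟨
    arr (C.re₁ (right T.id) C.Fib.id)  ≡⟨ re-≡id C.Fib.id right-≡id ⟩
    arr C.Fib.id                        ∎

  -- `dimap` acts on both sides; where only one side moves, the other contributes the reindexing of
  -- an identity.
  absorb-reˡ : ∀ {p q} (k : P.Hom p q) {x : C.Fib.Ob {q}} {y : C.Fib.Ob {p}}
               (u : C.Fib.Hom x (C.re₀ k y)) → arr (C.re₁ k C.Fib.id C.Fib.∘ u) ≡ arr u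
  absorb-reˡ k u = absorbˡ (re-pres-id k)

  absorb-reʳ : ∀ {p q} (k : P.Hom p q) {x : C.Fib.Ob {p}} {y : C.Fib.Ob {q}}
               (u : C.Fib.Hom (C.re₀ k x) y) → arr (u C.Fib.∘ C.re₁ k C.Fib.id) ≡ arr u
  absorb-reʳ k u = absorbʳ (re-pres-id k)

  -- In `Arr` the coercions inside `pulled` and `pushed` vanish. The halves `k` and `f` may lie in
  -- another fibre `p`, as in the unit laws.
  comp-arr : ∀ {γ b γ' b' γ'' b''} (a' : T.Hom (γ' , b') (γ'' , b'')) (a : T.Hom (γ , b) (γ' , b'))
             {c : C.Fib.Ob} {c' : C.Fib.Ob} {c'' : C.Fib.Ob}
             {p} {d e e' : C.Fib.Ob {p}} {k : C.Fib.Hom e e'} {f : C.Fib.Hom d e}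
             (θ' : Θ a' c' c'') (θ : Θ a c c') →
             arr (C.re₁ (pull (proj₁ a') a) θ') ≡ arr k →
             arr (C.re₁ (push (proj₁ a') (proj₁ a)) θ) ≡ arr f →
             arr (comp a' a θ' θ) ≡ arr (k C.Fib.∘ f)
  comp-arr a' a θ' θ p q = ∘-cong (trans (pulledA a' a θ') p) (trans (pushedA a' a θ) q)

  module _ {γ b γ' b' γ'' b''} (a' : T.Hom (γ' , b') (γ'' , b'')) (a : T.Hom (γ , b) (γ' , b')) where
    private
      g' = proj₁ a'
      g  = proj₁ a

    re-pull-right : ∀ {c c' : C.Fib.Ob {γ'' , b''}} (k : C.Fib.Hom c c') →
                    arr (C.re₁ (pull g' a) (C.re₁ (right a') k)) ≡ arr (C.re₁ (right (a' T.∘ a)) k)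
    re-pull-right k = trans (sym (re-∘ _ _ k)) (re-cong (cong PA.arr (pull-right a' a)) refl)

    re-push-left : ∀ {c c' : C.Fib.Ob {γ , b}} (f : C.Fib.Hom c c') →
                   arr (C.re₁ (push g' g) (C.re₁ (left g) f)) ≡ arr (C.re₁ (left (g' Γ.∘ g)) f)
    re-push-left f = trans (sym (re-∘ _ _ f)) (re-cong (cong PA.arr (push-left g' g)) refl)

    -- The two routes from `(γ' , b')` to the fibre of the composite form a commuting square;
    -- dinaturality and both unit laws rest on it.
    re-push-right : ∀ {c c' : C.Fib.Ob {γ' , b'}} (k : C.Fib.Hom c c') →
                    arr (C.re₁ (push g' g) (C.re₁ (right a) k)) ≡
                    arr (C.re₁ (pull g' a) (C.re₁ (left g') k))
    re-push-right k = begin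
      arr (C.re₁ (push g' g) (C.re₁ (right a) k))  ≡⟨ re-∘ _ _ k ⟨
      arr (C.re₁ (push g' g P.∘ right a) k)        ≡⟨ re-cong (cong PA.arr (push-right g' a)) refl ⟩
      arr (C.re₁ (pull g' a P.∘ left g') k)        ≡⟨ re-∘ _ _ k ⟩
      arr (C.re₁ (pull g' a) (C.re₁ (left g') k))  ∎

    comp-natural : ∀ {c d : C.Fib.Ob {γ , b}} {c' : C.Fib.Ob} {c'' d'' : C.Fib.Ob {γ'' , b''}}
                   (f : C.Fib.Hom d c) (k : C.Fib.Hom c'' d'') (θ' : Θ a' c' c'') (θ : Θ a c c') →
                   arr (C.re₁ (right (a' T.∘ a)) k C.Fib.∘
                        (comp a' a θ' θ C.Fib.∘ C.re₁ (left (g' Γ.∘ g)) f)) ≡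
                   arr (comp a' a (C.re₁ (right a') k C.Fib.∘ (θ' C.Fib.∘ C.re₁ (left g') C.Fib.id))
                                  (C.re₁ (right a) C.Fib.id C.Fib.∘ (θ C.Fib.∘ C.re₁ (left g) f)))
    comp-natural f k θ' θ = begin
      arr (K C.Fib.∘ ((pulled a' a θ' C.Fib.∘ pushed a' a θ) C.Fib.∘ F))
        ≡⟨ ∘-cong refl (cong arr (C.Fib.assoc _ _ _)) ⟩
      arr (K C.Fib.∘ (pulled a' a θ' C.Fib.∘ (pushed a' a θ C.Fib.∘ F)))
        ≡⟨ cong arr (C.Fib.assoc _ _ _) ⟨
      arr ((K C.Fib.∘ pulled a' a θ') C.Fib.∘ (pushed a' a θ C.Fib.∘ F))
        -- Read from the bottom up: `pull` and `push` distribute over the actions, the idle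
        -- identities vanish, and `pull-right` and `push-left` turn the outer factors into `K` and
        -- `F`.
        ≡⟨ comp-arr a' a _ _
             (trans (re-cong refl (∘-cong refl (absorb-reʳ (left g') θ')))
               (trans (cong arr (F-∘ (C.Re (pull g' a)) _ _))
                 (∘-cong (re-pull-right k) (sym (pulledA a' a θ')))))
             (trans (re-cong refl (absorb-reˡ (right a) _))
               (trans (cong arr (F-∘ (C.Re (push g' g)) _ _))
                 (∘-cong (sym (pushedA a' a θ)) (re-push-left f)))) ⟨
      _ ∎
      where
      open Functor
      K = C.re₁ (right (a' T.∘ a)) k
      F = C.re₁ (left (g' Γ.∘ g)) f

    -- Acting by `k` on either half inserts the same middle factor `L`, by `re-push-right`;
    -- reassociation moves it across.
    comp-dinatural : ∀ {c : C.Fib.Ob} {c' d' : C.Fib.Ob {γ' , b'}} {c'' : C.Fib.Ob}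
                     (k : C.Fib.Hom c' d') (θ' : Θ a' d' c'') (θ : Θ a c c') →
                     arr (comp a' a (C.re₁ (right a') C.Fib.id C.Fib.∘ (θ' C.Fib.∘ C.re₁ (left g') k)) θ) ≡
                     arr (comp a' a θ' (C.re₁ (right a) k C.Fib.∘ (θ C.Fib.∘ C.re₁ (left g) C.Fib.id)))
    comp-dinatural k θ' θ = begin
      _ ≡⟨ comp-arr a' a _ _
             (trans (re-cong refl (absorb-reˡ (right a') _))
               (trans (cong arr (F-∘ (C.Re (pull g' a)) _ _)) (∘-cong (sym (pulledA a' a θ')) refl)))
             (sym (pushedA a' a θ)) ⟩
      arr ((pulled a' a θ' C.Fib.∘ L) C.Fib.∘ pushed a' a θ)
        ≡⟨ cong arr (C.Fib.assoc _ _ _) ⟩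
      arr (pulled a' a θ' C.Fib.∘ (L C.Fib.∘ pushed a' a θ))
        ≡⟨ ∘-cong refl (trans (pushedA a' a _)
             (trans (re-cong refl (∘-cong refl (absorb-reʳ (left g) θ)))
               (trans (cong arr (F-∘ (C.Re (push g' g)) _ _))
                 (∘-cong (re-push-right k) (sym (pushedA a' a θ)))))) ⟨
      _ ∎
      where
      open Functor
      L = C.re₁ (pull g' a) (C.re₁ (left g') k)

  module _ {γ b γ' b'} (a : T.Hom (γ , b) (γ' , b')) where
    private g = proj₁ a

    comp-unitˡ : ∀ {c : C.Fib.Ob} {c' d' : C.Fib.Ob {γ' , b'}} (k : C.Fib.Hom c' d')
                 {v : Θ T.id c' d'} → arr v ≡ arr k → (θ : Θ a c c') →
                 arr (comp T.id a v θ) ≡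
                 arr (C.re₁ (right a) k C.Fib.∘ (θ C.Fib.∘ C.re₁ (left g) C.Fib.id))
    comp-unitˡ k {v} v≡k θ = comp-arr T.id a v θ
      (begin
        -- Rewriting `v` as `C(left id)k` makes the square for `a' = T.id` applicable; it trades
        -- `pull` for `push Γ.id g`, an identity.
        arr (C.re₁ (pull Γ.id a) v)                     ≡⟨ re-cong refl v≡re-k ⟩
        arr (C.re₁ (pull Γ.id a) (C.re₁ (left Γ.id) k)) ≡⟨ re-push-right T.id a k ⟨
        arr (C.re₁ (push Γ.id g) (C.re₁ (right a) k))   ≡⟨ re-≡id _ (push-id g) ⟩
        arr (C.re₁ (right a) k)                         ∎)
      (trans (re-≡id θ (push-id g)) (sym (absorb-reʳ (left g) θ)))
      where
      v≡re-k = trans v≡k (sym (re-≡id k left-≡id))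

    comp-unitʳ : ∀ {c d : C.Fib.Ob {γ , b}} {c' : C.Fib.Ob} (f : C.Fib.Hom d c)
                 {u : Θ T.id d c} → arr u ≡ arr f → (θ : Θ a c c') →
                 arr (comp a T.id θ u) ≡
                 arr (C.re₁ (right a) C.Fib.id C.Fib.∘ (θ C.Fib.∘ C.re₁ (left g) f))
    comp-unitʳ f {u} u≡f θ = trans
      (comp-arr a T.id θ u (re-≡id θ (pull-id g))
        (begin
          -- The mirror argument, with `C(right id)f` and the square for `a = T.id`.
          arr (C.re₁ (push g Γ.id) u)                        ≡⟨ re-cong refl u≡re-f ⟩
          arr (C.re₁ (push g Γ.id) (C.re₁ (right T.id) f))  ≡⟨ re-push-right a T.id f ⟩
          arr (C.re₁ (pull g T.id) (C.re₁ (left g) f))       ≡⟨ re-≡id _ (pull-id g) ⟩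
          arr (C.re₁ (left g) f)                             ∎))
      (sym (absorb-reˡ (right a) _))
      where
      u≡re-f = trans u≡f (sym (re-≡id f right-≡id))

  isTyᵈ : IsTyᵈ twist
  isTyᵈ = record
    { normal    = λ _ → record
        { El-≡    = Hom-re-≡id C left-id left-≡id
        ; dimap-≅ = λ f k u≅v → arr⇒≅ (∘-cong (re-≡id k right-≡id)
                      (∘-cong (Θ-id⇒arr u≅v) (re-≡id f left-≡id)))
        }
    ; natural   = λ {_} {_} {_} {a'} {a} f k v u → arr⁻¹ (comp-natural a' a f k v u)
    ; dinatural = λ {_} {_} {_} {a'} {a} k v u → arr⁻¹ (comp-dinatural a' a k v u)
    ; unitˡ     = λ {_} {_} {a} k v≅k u → arr⇒≅ (comp-unitˡ a k (Θ-id⇒arr v≅k) u)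
    ; unitʳ     = λ {_} {_} {a} f u≅f v → arr⇒≅ (comp-unitʳ a f (Θ-id⇒arr u≅f) v)
    ; assoc     = λ {_} {_} {_} {_} {a''} {a'} {a} t v u → arr⇒≅ (comp-assoc a'' a' a t v u)
    }

  -- Comparison of the total categories.

  unit≡twist-id : ∀ {γ b} {c : C.Fib.Ob {γ , b}} → IsTyᵈ.unit isTyᵈ {x = c} ≡ twist-id
  unit≡twist-id = arr⁻¹ (trans (Θ-id⇒arr (IsTyᵈ.unit-≅ isTyᵈ)) (sym twist-id-arr))

  -- The two sides differ by the bracketing of pairs, so all but the identities agrees
  -- definitionally: `unit` is `C.Fib.id` transported along `normal`, whereas `twist-id` is a
  -- coercion.
  ∫-iso : IsoOver (proj (tyᵈ twist isTyᵈ)) projection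
  ∫-iso = record
    { to      = record
        { F₀   = λ ((γ , b) , c) → γ , b , c
        ; F₁   = λ ((g , β) , θ) → g , β , θ
        ; F-id = cong (λ θ → _ , _ , θ) unit≡twist-id
        ; F-∘  = λ _ _ → refl
        }
    ; from    = record
        { F₀   = λ (γ , b , c) → (γ , b) , c
        ; F₁   = λ (g , β , θ) → (g , β) , θ
        ; F-id = cong (_ ,_) (sym unit≡twist-id)
        ; F-∘  = λ _ _ → refl
        }
    ; from∘to = record { eq₀ = λ _ → refl ; eq₁ = λ _ → refl }
    ; to∘from = record { eq₀ = λ _ → refl ; eq₁ = λ _ → refl }
    ; over    = record { eq₀ = λ _ → refl ; eq₁ = λ _ → refl }
    }

-- Twisting a type that does not depend on `b`.

module _ {Γ : Category o h} (B : Ty Γ o₁ h₁) (C : Ty Γ o₂ h₂) where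
  private
    module T = Category (Γ ⋄ B)
    module C = Ty C
    module W = FibreArrows (C [ wk (B ᵒᵖ) ])
  open FibreArrows C
  open Twist B (C [ wk (B ᵒᵖ) ])

  -- The fibres of the weakened type are definitionally those of `C`, but `W.Arr` also records `b`
  -- in the base, which is forgotten before the laws of `C` apply.
  unwk : ∀ {p p'} {x y : C.Fib.Ob {proj₁ p}} {x' y' : C.Fib.Ob {proj₁ p'}}
         {f : C.Fib.Hom x y} {f' : C.Fib.Hom x' y'} →
         W.arr {p} f ≡ W.arr {p'} f' → arr f ≡ arr f'
  unwk refl = refl

  -- `pull` lies over `id` and `push g' g` over `g'`, so the twisted composite reduces to `θ'` after
  -- `C(g')θ`.
  comp-wk : ∀ {γ b γ' b' γ'' b''} (a' : T.Hom (γ' , b') (γ'' , b'')) (a : T.Hom (γ , b) (γ' , b'))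
            {c : C.Fib.Ob {γ}} {c' : C.Fib.Ob {γ'}} {c'' : C.Fib.Ob {γ''}}
            {θ' : Θ a' c' c''} {θ : Θ a c c'}
            {v : C.Fib.Hom (C.re₀ (proj₁ a') c') c''} {u : C.Fib.Hom (C.re₀ (proj₁ a) c) c'} →
            arr θ' ≡ arr v → arr θ ≡ arr u →
            arr (comp a' a θ' θ) ≡ arr (v C.Fib.∘ C.re₁⁺ (proj₁ a') (proj₁ a) u)
  comp-wk a'@(g' , _) a@(g , _) {θ' = θ'} {θ} {v} {u} θ'≡v θ≡u = ∘-cong
    (trans (unwk (pulledA a' a θ')) (trans (re-id θ') θ'≡v))
    (trans (unwk (pushedA a' a θ)) (trans (re-cong refl θ≡u) (sym (re⁺ g' g u))))

  Tw-wk : Tw B (C [ wk (B ᵒᵖ) ]) ≗ᵈ Tyᵈ.raw ⌜ C [ wk B ] ⌝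
  Tw-wk = record
    -- This `refl` lets the `subst₂` in `Prof-≗` compute away; the profunctors then differ only by
    -- `C(id)y` against `y`.
    { Fib-≡  = λ _ → refl
    ; Prof-≗ = λ _ → record
        { El-≡    = λ _ y → cong (C.Fib.Hom _) (C.re₀-id y)
        ; dimap-≅ = λ f k u≅v → arr⇒≅ (∘-cong (re-id k)
                      (∘-cong (≅⇒arr refl (C.re₀-id _) u≅v) refl))
        }
    ; ⊙-≅    = λ { {g' = a'} {g = a} refl refl refl v≅v' u≅u' → arr⇒≅ (comp-wk a' a
                 (≅⇒arr refl (C.re₀-id _) v≅v') (≅⇒arr refl (C.re₀-id _) u≅u')) }
    }

proposition21 : ∀ {o h o₁ h₁ o₂ h₂} (Γ : Category o h) (B : Ty Γ o₁ h₁) →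
    ((C : Ty (Γ ⋄ B ᵒᵖ) o₂ h₂) →
    Σ[ isTyᵈ ∈ IsTyᵈ (Tw B C) ] IsoOver (proj (tyᵈ (Tw B C) isTyᵈ)) (π₂ B C))
    ×
    ((C : Ty Γ o₂ h₂) →
    Tw B (C [ wk (B ᵒᵖ) ]) ≗ᵈ Tyᵈ.raw ⌜ C [ wk B ] ⌝)
proposition21 Γ B = (λ C → TwistLaws.isTyᵈ B C , TwistLaws.∫-iso B C) , Tw-wk B
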